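{- Let $G$ be a loopy graph. Then there exist infinitely many numerical semigroups $S$ such that the graph $G(S)$ is isomorphic to $G$.
   Context: A loopy graph is a finite graph with no isolated vertices and no multiple edges, but possibly with loops. A numerical semigroup is a subset $S\subseteq\mathbb N$ containing $0$, closed under addition, with finite complement; $m=\min(S\setminus\{0\})$ is its multiplicity. Let $X=\{s\in S\setminus\{0\}: s-m\notin S\}$ (nonzero Apéry elements). The graph $G(S)$ has edge set consisting of all subsets $\{x,y\}\subseteq X$ (with $x=y$ allowed, giving a loop) such that $x+y\in X$, and vertex set the set of all endvertices of these edges. -}

module Defs where

open import Data.Fin.Base using (Fin)
open import Data.List.Base using (List)
open import Data.List.Extrema.Nat using (max; xs≤max)
import Data.List.Membership.Propositional as List
import Data.List.Relation.Unary.All as All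
open import Data.Nat.Base using (ℕ; zero; suc; _+_; _∸_; _≤_; z≤n; s≤s)
open import Data.Nat.Properties using (_≟_; +-comm; 1+n≰n)
open import Data.Product.Base using (Σ; Σ-syntax; ∃; ∃-syntax; _×_; _,_; proj₁; proj₂)
open import Function.Bundles using (Inverse; Injection; _⇔_)
open import Level using (0ℓ) renaming (suc to lsuc)
open import Relation.Binary.Bundles using (Setoid)
open import Relation.Binary.Core using (Rel)
import Relation.Binary.Construct.On as On
import Relation.Binary.Definitions as Binary
open import Relation.Binary.PropositionalEquality using (_≡_; _≢_; refl; subst; setoid)
open import Relation.Nullary using (yes; no; ¬?; contradiction; decidable-stable)
open import Relation.Nullary.Decidable using (_×-dec_)
open import Relation.Unary using (Pred; Decidable; _∈_; _∉_; ∁; _≐_)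
open import Relation.Unary.Relation.Binary.Equality using (≐-setoid)

-- A graph without multiple edges, possibly with loops: {x , y} is an edge
-- iff Edge x y, and there is a loop at x iff Edge x x.
record Graph : Set₁ where
  field
    vertices : Setoid 0ℓ 0ℓ
  open Setoid vertices public using (_≈_) renaming (Carrier to Vertex)
  field
    Edge      : Rel Vertex 0ℓ
    Edge-sym  : Binary.Symmetric Edge
    Edge-resp : Edge Binary.Respects₂ _≈_

-- A vertex is isolated if it is not an endvertex of any edge; in particular
-- a vertex whose only edge is a loop is not isolated.
-- Edge? is automatic classically; constructively it is part of finiteness.
record IsLoopy (G : Graph) : Set where
  open Graph G
  field
    finite      : ∃[ n ] Inverse vertices (setoid (Fin n))
    Edge?       : Binary.Decidable Edge
    no-isolated : ∀ x → ∃[ y ] Edge x y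

record LoopyGraph : Set₁ where
  field
    graph   : Graph
    isLoopy : IsLoopy graph
  open Graph graph public
  open IsLoopy isLoopy public

record _≅_ (G H : Graph) : Set where
  private
    module G = Graph G
    module H = Graph H
  field
    bijection : Inverse G.vertices H.vertices
  open Inverse bijection public using (to; from)
  field
    edges : ∀ x y → G.Edge x y ⇔ H.Edge (to x) (to y)

-- Decidability of membership is automatic classically; it is what makes the
-- minimum defining the multiplicity computable.
record NumericalSemigroup : Set₁ where
  field
    Carrier           : Pred ℕ 0ℓ
    _∈?               : Decidable Carrier
    0∈                : 0 ∈ Carrier
    +-closed          : ∀ {x y} → x ∈ Carrier → y ∈ Carrier → x + y ∈ Carrier
    finite-complement : Σ[ gaps ∈ List ℕ ] ∁ Carrier ≐ (List._∈ gaps)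

IsMinimum : Pred ℕ 0ℓ → Pred ℕ 0ℓ
IsMinimum P m = m ∈ P × (∀ {k} → k ∈ P → m ≤ k)

minimum : {P : Pred ℕ 0ℓ} → Decidable P → ∀ n → n ∈ P → ∃ (IsMinimum P)
minimum P? zero p = zero , p , λ _ → z≤n
minimum {P} P? (suc n) p with P? 0
... | yes p₀ = zero , p₀ , λ _ → z≤n
... | no ¬p₀ with minimum (λ k → P? (suc k)) n p
...   | m , q , least = suc m , q , bound
  where
  bound : ∀ {k} → k ∈ P → suc m ≤ k
  bound {zero}  r = contradiction r ¬p₀
  bound {suc k} r = s≤s (least r)

module _ (S : NumericalSemigroup) where
  open NumericalSemigroup S

  Nonzero : Pred ℕ 0ℓ
  Nonzero s = s ∈ Carrier × s ≢ 0

  private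
    nonzero? : Decidable Nonzero
    nonzero? s = (s ∈?) ×-dec ¬? (s ≟ 0)

    ∃nonzero : ∃ Nonzero
    ∃nonzero = n , decidable-stable (n ∈?) n∉∁ , λ ()
      where
      gaps = proj₁ finite-complement
      n = suc (max 0 gaps)
      n∉∁ : n ∉ ∁ Carrier
      n∉∁ n∉S = 1+n≰n (All.lookup (xs≤max 0 gaps) (proj₁ (proj₂ finite-complement) n∉S))

  multiplicity : ℕ
  multiplicity = proj₁ (minimum nonzero? (proj₁ ∃nonzero) (proj₂ ∃nonzero))

  multiplicity-isMinimum : IsMinimum Nonzero multiplicity
  multiplicity-isMinimum = proj₂ (minimum nonzero? (proj₁ ∃nonzero) (proj₂ ∃nonzero))

  -- The set X of nonzero Apéry elements.  Truncated subtraction is exact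
  -- here, as every nonzero s in S satisfies multiplicity ≤ s.
  Apéry : Pred ℕ 0ℓ
  Apéry s = s ∈ Nonzero × s ∸ multiplicity ∉ Carrier

  ApéryEdge : Rel ℕ 0ℓ
  ApéryEdge x y = x ∈ Apéry × y ∈ Apéry × x + y ∈ Apéry

  ApéryVertex : Pred ℕ 0ℓ
  ApéryVertex x = ∃[ y ] ApéryEdge x y

  -- The graph G(S).  Vertices are compared as natural numbers, ignoring the
  -- witness of being an endvertex.
  apéryGraph : Graph
  apéryGraph = record
    { vertices  = On.setoid (setoid ℕ) (proj₁ {B = ApéryVertex})
    ; Edge      = λ x y → ApéryEdge (proj₁ x) (proj₁ y)
    ; Edge-sym  = λ { {x , _} {y , _} (p , q , r) → q , p , subst Apéry (+-comm x y) r }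
    ; Edge-resp = (λ { refl e → e }) , (λ { refl e → e })
    }

-- Infinitely many numerical semigroups satisfy P: there is a sequence of
-- such semigroups that are pairwise distinct as subsets of ℕ.
InfinitelyManySemigroups : (NumericalSemigroup → Set) → Set₁
InfinitelyManySemigroups P = Injection (setoid ℕ) solutions
  where
  solutions : Setoid (lsuc 0ℓ) 0ℓ
  solutions = On.setoid (≐-setoid ℕ 0ℓ)
                (λ (S : Σ NumericalSemigroup P) → NumericalSemigroup.Carrier (proj₁ S))

{-# OPTIONS --safe #-}

-- Label the vertices of G by a Sidon set of positive integers s_i with all
-- s_i + s_j < N, and put m = 2N.  Let S consist of 0, m, the numbers
-- a_i = m + N + s_i, and all integers ≥ 2m except the holes 2m + s_i + s_j
-- for edges {i , j}.  All holes lie strictly between 2m and 2m + N, whereas a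
-- sum of two nonzero elements of S is either 2m or at least 2m + N; hence S is
-- a semigroup, of multiplicity m.  An Apéry element is an a_i or at least 2m,
-- so if x + y is Apéry then x and y must be some a_i and a_j (otherwise
-- x + y - m ≥ 2m + N lies in S), and a_i + a_j - m = 2m + s_i + s_j is missing
-- from S exactly when it is a hole, i.e. when {i , j} is an edge.  Varying N
-- gives infinitely many S.
module Submission where

open import Defs

open import Data.Fin.Base using (Fin; toℕ)
open import Data.Fin.Properties using (any?; toℕ-injective; toℕ<n)
open import Data.List.Base using (List; filter; upTo)
open import Data.List.Membership.Propositional.Properties using (∈-filter⁺; ∈-filter⁻; ∈-upTo⁺)
open import Data.Nat.Base using (ℕ; suc; _+_; _^_; _∸_; _≤_; _<_; z<s; s<s)
open import Data.Nat.Properties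
open import Data.Nat.Tactic.RingSolver using (solve-∀)
open import Data.Product.Base using (∃; ∃-syntax; _×_; _,_; proj₁; proj₂)
open import Data.Sum.Base using (_⊎_; inj₁; inj₂)
open import Function.Base using (_∘_)
open import Function.Bundles using (Inverse; mk⇔)
open import Level using (0ℓ)
open import Relation.Binary.Bundles using (Setoid)
open import Relation.Binary.Core using (Rel)
open import Relation.Binary.Definitions using (tri<; tri≈; tri>) renaming (Symmetric to Symmetric₂; Decidable to Decidable₂)
open import Relation.Binary.PropositionalEquality using (_≡_; _≢_; refl; sym; trans; cong; subst; subst₂)
open import Relation.Nullary using (¬_; ¬?; contradiction; decidable-stable)
open import Relation.Nullary.Decidable using (_×-dec_; _⊎-dec_)
open import Relation.Unary using (Pred; Decidable; _∈_)

-- Sidon labellings by powers of three.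

Sidon : ∀ {n} → (Fin n → ℕ) → Set
Sidon s = ∀ i j k l → s i + s j ≡ s k + s l → (i ≡ k × j ≡ l) ⊎ (i ≡ l × j ≡ k)

3^-injective : ∀ {i j} → 3 ^ i ≡ 3 ^ j → i ≡ j
3^-injective {i} {j} eq with <-cmp i j
... | tri< i<j _ _ = contradiction eq (<⇒≢ (^-monoʳ-< 3 (s<s z<s) i<j))
... | tri≈ _ i≡j _ = i≡j
... | tri> _ _ j<i = contradiction (sym eq) (<⇒≢ (^-monoʳ-< 3 (s<s z<s) j<i))

3^-positive : ∀ i → 0 < 3 ^ i
3^-positive i = m^n>0 3 i

-- The larger exponent dominates: two copies of `3 ^ j` stay below `3 ^ suc j`, whatever `k` is.
-- Hence equal sums have equal larger exponents, and the other terms then cancel.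
3^-sum-< : ∀ {i j k l} → i ≤ j → j < l → 3 ^ i + 3 ^ j < 3 ^ k + 3 ^ l
3^-sum-< {i} {j} {k} {l} i≤j j<l = begin-strict
  3 ^ i + 3 ^ j          ≤⟨ +-monoˡ-≤ (3 ^ j) (^-monoʳ-≤ 3 i≤j) ⟩
  3 ^ j + 3 ^ j          ≤⟨ +-monoʳ-≤ (3 ^ j) (m≤m+n (3 ^ j) _) ⟩
  3 ^ suc j              ≤⟨ ^-monoʳ-≤ 3 j<l ⟩
  3 ^ l                  <⟨ +-monoˡ-< (3 ^ l) (3^-positive k) ⟩
  3 ^ k + 3 ^ l          ∎
  where open ≤-Reasoning

3^-sidon-sorted : ∀ {i j k l} → i ≤ j → k ≤ l → 3 ^ i + 3 ^ j ≡ 3 ^ k + 3 ^ l → i ≡ k × j ≡ l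
3^-sidon-sorted {i} {j} {k} {l} i≤j k≤l eq with <-cmp j l
... | tri< j<l _ _ = contradiction eq (<⇒≢ (3^-sum-< {k = k} i≤j j<l))
... | tri≈ _ refl _ = 3^-injective (+-cancelʳ-≡ (3 ^ j) (3 ^ i) (3 ^ k) eq) , refl
... | tri> _ _ l<j = contradiction (sym eq) (<⇒≢ (3^-sum-< {k = i} k≤l l<j))

3^-sidon : ∀ i j k l → 3 ^ i + 3 ^ j ≡ 3 ^ k + 3 ^ l → (i ≡ k × j ≡ l) ⊎ (i ≡ l × j ≡ k)
3^-sidon i j k l eq with ≤-total i j | ≤-total k l
... | inj₁ i≤j | inj₁ k≤l = inj₁ (3^-sidon-sorted i≤j k≤l eq)
... | inj₁ i≤j | inj₂ l≤k = inj₂ (3^-sidon-sorted i≤j l≤k (trans eq (+-comm (3 ^ k) _)))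
... | inj₂ j≤i | inj₁ k≤l = let p , q = 3^-sidon-sorted j≤i k≤l (trans (+-comm (3 ^ j) _) eq) in inj₂ (q , p)
... | inj₂ j≤i | inj₂ l≤k =
  let p , q = 3^-sidon-sorted j≤i l≤k (trans (+-comm (3 ^ j) _) (trans eq (+-comm (3 ^ k) _))) in inj₁ (q , p)

3^toℕ-sidon : ∀ {n} → Sidon {n} (λ i → 3 ^ toℕ i)
3^toℕ-sidon i j k l eq with 3^-sidon (toℕ i) (toℕ j) (toℕ k) (toℕ l) eq
... | inj₁ (p , q) = inj₁ (toℕ-injective p , toℕ-injective q)
... | inj₂ (p , q) = inj₂ (toℕ-injective p , toℕ-injective q)

-- Comparing multiplicities.

isMinimum-unique : ∀ {P m n} → IsMinimum P m → IsMinimum P n → m ≡ n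
isMinimum-unique (m∈P , m≤) (n∈P , n≤) = ≤-antisym (m≤ n∈P) (n≤ m∈P)

-- Applied in both directions, this gives equal multiplicities to semigroups with equal carriers.
multiplicity-mono : ∀ S T → (∀ {x} → x ∈ NumericalSemigroup.Carrier S → x ∈ NumericalSemigroup.Carrier T) →
                    multiplicity T ≤ multiplicity S
multiplicity-mono S T S⊆T with multiplicity-isMinimum S
... | (m∈S , m≢0) , _ = proj₂ (multiplicity-isMinimum T) (S⊆T m∈S , m≢0)

-- The semigroup of a labelled graph.

module Construction
  {n : ℕ} (s : Fin n → ℕ) (s-positive : ∀ i → 0 < s i) (s-sidon : Sidon s)
  {E : Rel (Fin n) 0ℓ} (E? : Decidable₂ E) (E-sym : Symmetric₂ E)
  (N : ℕ) (N-positive : 0 < N) (s+s<N : ∀ i j → s i + s j < N)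
  where

  m : ℕ
  m = N + N

  a : Fin n → ℕ
  a i = m + (N + s i)

  Hole : Pred ℕ 0ℓ
  Hole x = ∃[ i ] ∃[ j ] (E i j × x ≡ m + m + (s i + s j))

  Member : Pred ℕ 0ℓ
  Member x = x ≡ 0 ⊎ x ≡ m ⊎ (∃[ i ] x ≡ a i) ⊎ (m + m ≤ x × ¬ Hole x)

  hole? : Decidable Hole
  hole? x = any? λ i → any? λ j → E? i j ×-dec (x ≟ m + m + (s i + s j))

  member? : Decidable Member
  member? x = (x ≟ 0) ⊎-dec (x ≟ m) ⊎-dec any? (λ i → x ≟ a i) ⊎-dec ((m + m ≤? x) ×-dec ¬? (hole? x))

  s<N : ∀ i → s i < N
  s<N i = ≤-<-trans (m≤m+n (s i) (s i)) (s+s<N i i)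

  m-positive : 0 < m
  m-positive = <-≤-trans N-positive (m≤m+n N N)

  m+N≤a : ∀ i → m + N ≤ a i
  m+N≤a i = +-monoʳ-≤ m (m≤m+n N (s i))

  a<m+m : ∀ i → a i < m + m
  a<m+m i = +-monoʳ-< m (+-monoʳ-< N (s<N i))

  m+N≤m+m : m + N ≤ m + m
  m+N≤m+m = +-monoʳ-≤ m (m≤m+n N N)

  a-injective : ∀ {i j} → a i ≡ a j → i ≡ j
  a-injective {i} {j} eq with +-cancelˡ-≡ N _ _ (+-cancelˡ-≡ m _ _ eq)
  -- The Sidon property at the doubled sums already makes the labels distinct.
  ... | si≡sj with s-sidon i i j j (subst (λ t → s i + s i ≡ t + t) si≡sj refl)
  ... | inj₁ (p , _) = p
  ... | inj₂ (p , _) = p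

  -- The two offsets `N` make up one more `m`, so subtracting `m` lands exactly on the position
  -- reserved for a hole at `{i , j}`.
  a+a : ∀ i j → a i + a j ≡ m + (m + m + (s i + s j))
  a+a i j = identity N (s i) (s j)
    where
    identity : ∀ N s t → (N + N + (N + s)) + (N + N + (N + t)) ≡ N + N + (N + N + (N + N) + (s + t))
    identity = solve-∀

  m+m<hole : ∀ {x} → Hole x → m + m < x
  m+m<hole (i , j , _ , refl) = m<m+n (m + m) (<-≤-trans (s-positive i) (m≤m+n _ _))

  hole<m+m+N : ∀ {x} → Hole x → x < m + m + N
  hole<m+m+N (i , j , _ , refl) = +-monoʳ-< (m + m) (s+s<N i j)

  large-member : ∀ {x} → m + m + N ≤ x → Member x
  large-member le = inj₂ (inj₂ (inj₂ (≤-trans (m≤m+n (m + m) N) le , λ h → <⇒≱ (hole<m+m+N h) le)))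

  -- Closure under addition depends only on the size of the summands, so the last two kinds of
  -- members are merged into one lower bound.
  trichotomy : ∀ {x} → Member x → x ≡ 0 ⊎ x ≡ m ⊎ m + N ≤ x
  trichotomy (inj₁ p) = inj₁ p
  trichotomy (inj₂ (inj₁ p)) = inj₂ (inj₁ p)
  trichotomy (inj₂ (inj₂ (inj₁ (i , refl)))) = inj₂ (inj₂ (m+N≤a i))
  trichotomy (inj₂ (inj₂ (inj₂ (le , _)))) = inj₂ (inj₂ (≤-trans m+N≤m+m le))

  m≤nonzero : ∀ {x} → Member x → x ≢ 0 → m ≤ x
  m≤nonzero x∈ x≢0 with trichotomy x∈
  ... | inj₁ p = contradiction p x≢0
  ... | inj₂ (inj₁ refl) = ≤-refl
  ... | inj₂ (inj₂ le) = ≤-trans (m≤m+n m N) le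

  m+[m+N]≤⇒member : ∀ {x} → m + (m + N) ≤ x → Member x
  m+[m+N]≤⇒member le = large-member (≤-trans (≤-reflexive (+-assoc m m N)) le)

  member-+ : ∀ {x y} → Member x → Member y → Member (x + y)
  member-+ {x} {y} x∈ y∈ with trichotomy x∈ | trichotomy y∈
  ... | inj₁ refl | _ = y∈
  ... | inj₂ _ | inj₁ refl = subst Member (sym (+-identityʳ x)) x∈
  -- The sum `m + m` may lie below some holes, but it is none itself because the labels are
  -- positive.
  ... | inj₂ (inj₁ refl) | inj₂ (inj₁ refl) = inj₂ (inj₂ (inj₂ (≤-refl , λ h → <-irrefl refl (m+m<hole h))))
  ... | inj₂ (inj₁ refl) | inj₂ (inj₂ le) = m+[m+N]≤⇒member (+-monoʳ-≤ m le)
  ... | inj₂ (inj₂ le) | inj₂ (inj₁ refl) = m+[m+N]≤⇒member (≤-trans (+-monoʳ-≤ m le) (≤-reflexive (+-comm m x)))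
  ... | inj₂ (inj₂ le) | inj₂ (inj₂ le′) =
    m+[m+N]≤⇒member (+-mono-≤ (≤-trans (m≤m+n m N) le) le′)

  gaps : List ℕ
  gaps = filter (¬? ∘ member?) (upTo (m + m + N))

  semigroup : NumericalSemigroup
  semigroup = record
    { Carrier = Member
    ; _∈? = member?
    ; 0∈ = inj₁ refl
    ; +-closed = member-+
    ; finite-complement = gaps
      , (λ x∉ → ∈-filter⁺ (¬? ∘ member?) (∈-upTo⁺ (≰⇒> (x∉ ∘ large-member))) x∉)
      , (λ x∈ → proj₂ (∈-filter⁻ (¬? ∘ member?) {xs = upTo (m + m + N)} x∈))
    }

  multiplicity≡m : multiplicity semigroup ≡ m
  multiplicity≡m = isMinimum-unique (multiplicity-isMinimum semigroup)
    ((inj₂ (inj₁ refl) , m<n⇒n≢0 m-positive) , λ (x∈ , x≢0) → m≤nonzero x∈ x≢0)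

  -- Apéry elements and edges.

  hole∉ : ∀ {x} → Hole x → ¬ Member x
  hole∉ h (inj₁ refl) = contradiction (m+m<hole h) λ ()
  hole∉ h (inj₂ (inj₁ refl)) = <⇒≱ (m+m<hole h) (m≤m+n m m)
  hole∉ h (inj₂ (inj₂ (inj₁ (i , refl)))) = <-asym (m+m<hole h) (a<m+m i)
  hole∉ h (inj₂ (inj₂ (inj₂ (_ , ¬h)))) = ¬h h

  apéry⁺ : ∀ {x} → Member (m + x) → ¬ Member x → Apéry semigroup (m + x)
  apéry⁺ {x} m+x∈ x∉ = (m+x∈ , m<n⇒n≢0 (<-≤-trans m-positive (m≤m+n m x)))
    , subst (λ k → ¬ Member (m + x ∸ k)) (sym multiplicity≡m)
        (subst (¬_ ∘ Member) (sym (m+n∸m≡n m x)) x∉)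

  apéry⁻ : ∀ {x} → Apéry semigroup x → ¬ Member (x ∸ m)
  apéry⁻ {x} (_ , x∸∉) = subst (λ k → ¬ Member (x ∸ k)) multiplicity≡m x∸∉

  a-apéry : ∀ i → Apéry semigroup (a i)
  -- `N + s i` lies strictly between 0 and `m`, hence below every nonzero member.
  a-apéry i = apéry⁺ (inj₂ (inj₂ (inj₁ (i , refl)))) λ N+s∈ →
    <⇒≱ (+-monoʳ-< N (s<N i)) (m≤nonzero N+s∈ (m<n⇒n≢0 (<-≤-trans N-positive (m≤m+n N _))))

  a-edge⁺ : ∀ {i j} → E i j → ApéryEdge semigroup (a i) (a j)
  a-edge⁺ {i} {j} e = a-apéry i , a-apéry j , subst (Apéry semigroup) (sym (a+a i j))
    (apéry⁺ (subst Member (a+a i j) (member-+ (proj₁ (proj₁ (a-apéry i))) (proj₁ (proj₁ (a-apéry j)))))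
            (hole∉ (i , j , e , refl)))

  apéry-cases : ∀ {x} → Apéry semigroup x → (∃[ i ] x ≡ a i) ⊎ m + m ≤ x
  apéry-cases ((inj₁ refl , 0≢0) , _) = contradiction refl 0≢0
  apéry-cases x@((inj₂ (inj₁ refl) , _) , _) = contradiction (inj₁ (n∸n≡0 m)) (apéry⁻ x)
  apéry-cases ((inj₂ (inj₂ (inj₁ p)) , _) , _) = inj₁ p
  apéry-cases ((inj₂ (inj₂ (inj₂ (le , _))) , _) , _) = inj₂ le

  m+N≤apéry : ∀ {x} → Apéry semigroup x → m + N ≤ x
  m+N≤apéry x∈ with apéry-cases x∈
  ... | inj₁ (i , refl) = m+N≤a i
  ... | inj₂ le = ≤-trans m+N≤m+m le

  -- Even after `m` is subtracted the sum lies beyond all holes. This leaves only the `a i` as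
  -- endvertices.
  ¬apéry-large : ∀ {x y} → m + m ≤ x → m + N ≤ y → ¬ Apéry semigroup (x + y)
  ¬apéry-large {x} {y} le le′ x+y∈ = apéry⁻ x+y∈ (large-member bound)
    where
    open ≤-Reasoning
    identity : ∀ m N → m + m + (m + N) ≡ m + (m + m + N)
    identity = solve-∀
    bound : m + m + N ≤ x + y ∸ m
    bound = begin
      m + m + N             ≡⟨ m+n∸m≡n m (m + m + N) ⟨
      m + (m + m + N) ∸ m   ≡⟨ cong (_∸ m) (identity m N) ⟨
      m + m + (m + N) ∸ m   ≤⟨ ∸-monoˡ-≤ m (+-mono-≤ le le′) ⟩
      x + y ∸ m             ∎

  -- A hole at this position could a priori come from another edge with the same label sum; the
  -- Sidon property leaves only a swap of the ends, which `E-sym` absorbs.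
  hole⇒E : ∀ i j → Hole (m + m + (s i + s j)) → E i j
  hole⇒E i j (k , l , kl , eq) with s-sidon i j k l (+-cancelˡ-≡ (m + m) _ _ eq)
  ... | inj₁ (refl , refl) = kl
  ... | inj₂ (refl , refl) = E-sym kl

  a-edge⁻ : ∀ {i j} → Apéry semigroup (a i + a j) → E i j
  -- If the reduced sum were no hole, it would be a member, being at least `m + m`; decidability of
  -- `Hole` removes the double negation.
  a-edge⁻ {i} {j} e = hole⇒E i j (decidable-stable (hole? _) λ ¬h → apéry⁻ e
    (subst Member (sym (trans (cong (_∸ m) (a+a i j)) (m+n∸m≡n m _)))
      (inj₂ (inj₂ (inj₂ (m≤m+n (m + m) _ , ¬h))))))

  edge⁻ : ∀ {x y} → ApéryEdge semigroup x y → ∃[ i ] ∃[ j ] (x ≡ a i × y ≡ a j × E i j)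
  edge⁻ {x} {y} (x∈ , y∈ , x+y∈) = by-cases (apéry-cases x∈) (apéry-cases y∈)
    where
    by-cases : (∃[ i ] x ≡ a i) ⊎ m + m ≤ x → (∃[ j ] y ≡ a j) ⊎ m + m ≤ y →
               ∃[ i ] ∃[ j ] (x ≡ a i × y ≡ a j × E i j)
    by-cases (inj₁ (i , x≡)) (inj₁ (j , y≡)) =
      i , j , x≡ , y≡ , a-edge⁻ (subst₂ (λ x y → Apéry semigroup (x + y)) x≡ y≡ x+y∈)
    by-cases (inj₂ le) _ = contradiction x+y∈ (¬apéry-large le (m+N≤apéry y∈))
    by-cases _ (inj₂ le) =
      contradiction (subst (Apéry semigroup) (+-comm x y) x+y∈) (¬apéry-large le (m+N≤apéry x∈))

-- Transfer to an arbitrary loopy graph.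

module Realisation (G : LoopyGraph) (t : ℕ) where
  open LoopyGraph G
  open Inverse (proj₂ finite) renaming (to to index; from to vertex; to-cong to index-cong; from-cong to vertex-cong)
  private module V = Setoid vertices

  n : ℕ
  n = proj₁ finite

  N : ℕ
  -- Every label is below `3 ^ n`; the free parameter `t` distinguishes the semigroups.
  N = t + (3 ^ n + 3 ^ n)

  3^toℕ-sum<N : ∀ (i j : Fin n) → 3 ^ toℕ i + 3 ^ toℕ j < N
  3^toℕ-sum<N i j = <-≤-trans (+-mono-< (lt i) (lt j)) (m≤n+m _ t)
    where
    lt : ∀ (i : Fin n) → 3 ^ toℕ i < 3 ^ n
    lt i = ^-monoʳ-< 3 (s<s z<s) (toℕ<n i)

  open Construction (λ i → 3 ^ toℕ i) (λ i → 3^-positive (toℕ i)) 3^toℕ-sidon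
    {E = λ i j → Edge (vertex i) (vertex j)} (λ i j → Edge? (vertex i) (vertex j)) Edge-sym
    N (<-≤-trans (3^-positive n) (≤-trans (m≤m+n _ _) (m≤n+m _ t))) 3^toℕ-sum<N public

  vertex-index : ∀ v → vertex (index v) ≈ v
  vertex-index v = inverseʳ refl

  edge-transport : ∀ {u u′ v v′} → u ≈ u′ → v ≈ v′ → Edge u v → Edge u′ v′
  edge-transport u≈ v≈ = proj₂ Edge-resp u≈ ∘ proj₁ Edge-resp v≈

  label : ∃ (ApéryVertex semigroup) → Fin n
  label (_ , _ , e) = proj₁ (edge⁻ e)

  a-label : ∀ x → proj₁ x ≡ a (label x)
  a-label (_ , _ , e) = proj₁ (proj₂ (proj₂ (edge⁻ e)))

  toApéryVertex : Vertex → ∃ (ApéryVertex semigroup)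
  toApéryVertex v =
    -- A neighbour of `v` is what makes `a (index v)` an endvertex.
    let w , e = no-isolated v in
    a (index v) , a (index w) , a-edge⁺ (edge-transport (V.sym (vertex-index v)) (V.sym (vertex-index w)) e)

  -- Although `label` is read off from the edge witnessing the vertex, it depends only on the
  -- underlying number, since `a` is injective.
  label-unique : ∀ x {i} → proj₁ x ≡ a i → label x ≡ i
  label-unique x eq = a-injective (trans (sym (a-label x)) eq)

  isomorphism : apéryGraph semigroup ≅ graph
  isomorphism = record
    { bijection = record
      { to        = vertex ∘ label
      ; from      = toApéryVertex
      ; to-cong   = λ {x} {y} x≡y → vertex-cong (label-unique x (trans x≡y (a-label y)))
      ; from-cong = cong a ∘ index-cong
      ; inverse   =
          (λ {v} {x} x≡ → V.trans (vertex-cong (label-unique x x≡)) (vertex-index v))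
        , (λ {x} v≈ → trans (cong a (inverseˡ v≈)) (sym (a-label x)))
      }
    ; edges = λ x y → mk⇔ (to-edge x y)
        (λ e → subst₂ (ApéryEdge semigroup) (sym (a-label x)) (sym (a-label y)) (a-edge⁺ e))
    }
    where
    to-edge : ∀ x y → ApéryEdge semigroup (proj₁ x) (proj₁ y) → Edge (vertex (label x)) (vertex (label y))
    to-edge x y e =
      let i , j , x≡ , y≡ , ij = edge⁻ e in
      subst₂ (λ i j → Edge (vertex i) (vertex j)) (sym (label-unique x x≡)) (sym (label-unique y y≡)) ij

-- Infinitely many realisations.

theorem6p1 : (G : LoopyGraph) → InfinitelyManySemigroups (λ S → apéryGraph S ≅ LoopyGraph.graph G)
theorem6p1 G = record
  { to        = λ t → R.semigroup t , R.isomorphism t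
  ; cong      = λ { refl → (λ p → p) , (λ p → p) }
  -- Equal carriers have equal multiplicity, twice `N`; halving it and cancelling the powers of
  -- three recovers the parameter.
  ; injective = λ {t} {u} (t⊆u , u⊆t) → +-cancelʳ-≡ _ t u (double-injective (m-injective t u t⊆u u⊆t))
  }
  where
  module R = Realisation G
  m-injective : ∀ t u → (∀ {x} → R.Member t x → R.Member u x) → (∀ {x} → R.Member u x → R.Member t x) →
                R.m t ≡ R.m u
  m-injective t u t⊆u u⊆t = subst₂ _≡_ (R.multiplicity≡m t) (R.multiplicity≡m u)
    (≤-antisym (multiplicity-mono (R.semigroup u) (R.semigroup t) u⊆t)
               (multiplicity-mono (R.semigroup t) (R.semigroup u) t⊆u))
  double-injective : ∀ {p q} → p + p ≡ q + q → p ≡ q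
  double-injective {p} {q} eq with <-cmp p q
  ... | tri< p<q _ _ = contradiction eq (<⇒≢ (+-mono-< p<q p<q))
  ... | tri≈ _ p≡q _ = p≡q
  ... | tri> _ _ q<p = contradiction (sym eq) (<⇒≢ (+-mono-< q<p q<p))
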